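{- There is a function $f$ such that for every graph $G$, the property that a vertex set $S\subseteq V(G)$ is a geodetic set of $G$ can be expressed by an $\mathrm{MSO}_1$ formula (with free set variable $S$) of length at most $f(\mathrm{diam}(G))$; consequently \textsc{Geodetic Set} is expressible in $\mathrm{MSO}_1$ logic by a formula of length $f(\mathrm{diam}(G))$.
   Context: Graphs are finite, undirected and simple. The interval $I[u,v]$ is the set of vertices on some shortest $u$--$v$-path (including $u,v$); $S\subseteq V(G)$ is geodetic if every vertex of $G$ lies in $I[u,v]$ for some $u,v\in S$. \textsc{Geodetic Set}: given $G$ and integer $k$, decide whether $G$ has a geodetic set of size at most $k$. $\mathrm{diam}(G)$ is the maximum distance between two vertices of $G$. $\mathrm{MSO}_1$ is monadic second-order logic on graphs with quantification over vertices and vertex sets and the adjacency relation. -}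

module Defs where

open import Data.Nat using (ℕ; zero; suc; _+_; _≤_)
open import Data.Bool using (Bool; true; false; T)
open import Data.Fin using (Fin)
open import Data.Fin.Subset using (Subset; _∈_)
open import Data.Vec using (Vec; []; _∷_; lookup; head; last)
open import Data.Product using (Σ; ∃; _×_; _,_)
open import Data.Sum using (_⊎_)
open import Data.Empty using (⊥)
open import Relation.Nullary using (¬_)
open import Relation.Binary.PropositionalEquality using (_≡_)

record Graph : Set where
  field
    n     : ℕ
    adj   : Fin n → Fin n → Bool
    sym   : ∀ u v → adj u v ≡ adj v u
    irref : ∀ u → adj u u ≡ false

open Graph public

Vertex : Graph → Set
Vertex G = Fin (n G)

Adj : (G : Graph) → Vertex G → Vertex G → Set
Adj G u v = T (adj G u v)

-- Walks: a walk of length k is a sequence of k+1 vertices, consecutive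
-- ones adjacent.  Shortest paths are walks of minimum length.

data Walk (G : Graph) : Vertex G → Vertex G → ℕ → Set where
  here : ∀ u → Walk G u u zero
  step : ∀ {u w v k} → Adj G u w → Walk G w v k → Walk G u v (suc k)

data OnWalk (G : Graph) (x : Vertex G) : ∀ {u v k} → Walk G u v k → Set where
  on-here : OnWalk G x (here x)
  on-head : ∀ {w v k} (a : Adj G x w) (p : Walk G w v k) → OnWalk G x (step a p)
  on-tail : ∀ {u w v k} (a : Adj G u w) {p : Walk G w v k} →
            OnWalk G x p → OnWalk G x (step a p)

IsDist : (G : Graph) → Vertex G → Vertex G → ℕ → Set
IsDist G u v d = Walk G u v d × (∀ k → Walk G u v k → d ≤ k)

InInterval : (G : Graph) → Vertex G → Vertex G → Vertex G → Set
InInterval G u v x =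
  Σ ℕ λ d → IsDist G u v d × Σ (Walk G u v d) λ p → OnWalk G x p

Geodetic : (G : Graph) → Subset (n G) → Set
Geodetic G S = ∀ x → Σ (Vertex G) λ u → Σ (Vertex G) λ v →
  u ∈ S × v ∈ S × InInterval G u v x

-- D is the diameter of G (all distances finite, i.e. G connected,
-- all at most D, and D is attained)
IsDiam : Graph → ℕ → Set
IsDiam G D =
  (∀ u v → Σ ℕ λ d → IsDist G u v d × d ≤ D) ×
  Σ (Vertex G) λ u → Σ (Vertex G) λ v → IsDist G u v D

-- MSO₁ formulas with i free vertex variables and j free set variables
-- (de Bruijn indices), over the signature {adjacency, =, ∈}.

data Form : ℕ → ℕ → Set where
  adjF : ∀ {i j} → Fin i → Fin i → Form i j
  eqF  : ∀ {i j} → Fin i → Fin i → Form i j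
  memF : ∀ {i j} → Fin i → Fin j → Form i j
  negF : ∀ {i j} → Form i j → Form i j
  andF : ∀ {i j} → Form i j → Form i j → Form i j
  orF  : ∀ {i j} → Form i j → Form i j → Form i j
  ex1  : ∀ {i j} → Form (suc i) j → Form i j
  all1 : ∀ {i j} → Form (suc i) j → Form i j
  ex2  : ∀ {i j} → Form i (suc j) → Form i j
  all2 : ∀ {i j} → Form i (suc j) → Form i j

len : ∀ {i j} → Form i j → ℕ
len (adjF _ _) = 1
len (eqF _ _)  = 1
len (memF _ _) = 1
len (negF φ)   = suc (len φ)
len (andF φ ψ) = suc (len φ + len ψ)
len (orF φ ψ)  = suc (len φ + len ψ)
len (ex1 φ)    = suc (len φ)
len (all1 φ)   = suc (len φ)
len (ex2 φ)    = suc (len φ)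
len (all2 φ)   = suc (len φ)

Sat : (G : Graph) → ∀ {i j} → Vec (Vertex G) i → Vec (Subset (n G)) j →
      Form i j → Set
Sat G ρ σ (adjF a b) = Adj G (lookup ρ a) (lookup ρ b)
Sat G ρ σ (eqF a b)  = lookup ρ a ≡ lookup ρ b
Sat G ρ σ (memF a X) = lookup ρ a ∈ lookup σ X
Sat G ρ σ (negF φ)   = ¬ Sat G ρ σ φ
Sat G ρ σ (andF φ ψ) = Sat G ρ σ φ × Sat G ρ σ ψ
Sat G ρ σ (orF φ ψ)  = Sat G ρ σ φ ⊎ Sat G ρ σ ψ
Sat G ρ σ (ex1 φ)    = Σ (Vertex G) λ x → Sat G (x ∷ ρ) σ φ
Sat G ρ σ (all1 φ)   = ∀ x → Sat G (x ∷ ρ) σ φ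
Sat G ρ σ (ex2 φ)    = Σ (Subset (n G)) λ X → Sat G ρ (X ∷ σ) φ
Sat G ρ σ (all2 φ)   = ∀ X → Sat G ρ (X ∷ σ) φ

module Submission where

-- Idea.  "There is a walk of length ≤ k from a to b" is expressed by a
-- formula of length O(k) that guesses the walk vertex by vertex
-- (`within`).  Distances in G are at most D, so x lies on a shortest
-- u–v path exactly when, for some a, b ≤ D, there are walks u ⇝ x of
-- length a and x ⇝ v of length b and no u–v walk shorter than a + b.
-- Ranging over the (D+1)² choices of (a, b) by a finite disjunction
-- gives a formula `intervalF D` for "x ∈ I[u,v]", and S is geodetic iff
-- ∀x ∃u ∃v (u ∈ S ∧ v ∈ S ∧ x ∈ I[u,v]).

open import Defs
open import Data.Nat using (ℕ; zero; suc; _+_; _≤_; _<_; z≤n; s≤s; _≤?_)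
open import Data.Nat.Properties
  using (≤-refl; ≤-trans; n≤1+n; m≤n⇒m<n∨m≡n; ≰⇒>; <-≤-trans; <-irrefl;
         +-mono-≤; m+n≤o⇒m≤o; m+n≤o⇒n≤o)
open import Data.Fin using (Fin) renaming (zero to fz; suc to fs)
open import Data.Fin.Subset using (Subset)
open import Data.Vec using (Vec; []; _∷_; lookup)
open import Data.Product using (Σ; _×_; _,_)
open import Data.Sum using (inj₁; inj₂)
open import Data.Empty using (⊥-elim)
open import Relation.Nullary using (¬_; yes; no)
open import Relation.Binary.PropositionalEquality
  using (_≡_; refl; trans; subst; cong) renaming (sym to ≡-sym)
open import Function.Bundles using (_⇔_; mk⇔; Equivalence)

open Equivalence

Minimal : (G : Graph) → Vertex G → Vertex G → ℕ → Set
Minimal G u v d = ∀ k → Walk G u v k → d ≤ k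

-- "there is a walk of length at most k from variable a to variable b":
-- either a = b, or some neighbour of a reaches b within k - 1 steps.
within : ∀ {i j} → ℕ → Fin i → Fin i → Form i j
within zero    a b = eqF a b
within (suc k) a b = orF (eqF a b) (ex1 (andF (adjF (fs a) fz) (within k fz (fs b))))

shorter : ∀ {i j} → ℕ → Fin i → Fin i → Form i j
shorter zero    a b = negF (eqF a a)
shorter (suc k) a b = within k a b

bigOr : ∀ {i j} → (ℕ → Form i j) → ℕ → Form i j
bigOr g zero    = g 0
bigOr g (suc n) = orF (bigOr g n) (g (suc n))

module _ (G : Graph) where

  walk-of-≡ : ∀ {u v} → u ≡ v → Walk G u v 0
  walk-of-≡ refl = here _

  within-sound : ∀ k {i j} (ρ : Vec (Vertex G) i) (σ : Vec (Subset (n G)) j) a b →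
    Sat G ρ σ (within k a b) → Σ ℕ λ m → m ≤ k × Walk G (lookup ρ a) (lookup ρ b) m
  within-sound zero    ρ σ a b a≡b        = 0 , z≤n , walk-of-≡ a≡b
  within-sound (suc k) ρ σ a b (inj₁ a≡b) = 0 , z≤n , walk-of-≡ a≡b
  within-sound (suc k) ρ σ a b (inj₂ (w , a~w , rest))
    with within-sound k (w ∷ ρ) σ fz (fs b) rest
  ... | m , m≤k , p = suc m , s≤s m≤k , step a~w p

  -- The endpoints are given up to equality so that the walk can be split
  -- by pattern matching.
  within-complete : ∀ k {u v m} → Walk G u v m → m ≤ k →
    ∀ {i j} (ρ : Vec (Vertex G) i) (σ : Vec (Subset (n G)) j) a b →
    lookup ρ a ≡ u → lookup ρ b ≡ v → Sat G ρ σ (within k a b)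
  within-complete zero    (here _) _ ρ σ a b ea eb = trans ea (≡-sym eb)
  within-complete (suc k) (here _) _ ρ σ a b ea eb = inj₁ (trans ea (≡-sym eb))
  within-complete (suc k) (step {w = w} u~w p) (s≤s m≤k) ρ σ a b ea eb =
    inj₂ (w , subst (λ y → Adj G y w) (≡-sym ea) u~w ,
          within-complete k p m≤k (w ∷ ρ) σ fz (fs b) refl eb)

  shorter-sound : ∀ k {i j} (ρ : Vec (Vertex G) i) (σ : Vec (Subset (n G)) j) a b →
    Sat G ρ σ (shorter k a b) → Σ ℕ λ m → m < k × Walk G (lookup ρ a) (lookup ρ b) m
  shorter-sound zero    ρ σ a b a≢a = ⊥-elim (a≢a refl)
  shorter-sound (suc k) ρ σ a b s with within-sound k ρ σ a b s
  ... | m , m≤k , p = m , s≤s m≤k , p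

  shorter-complete : ∀ k {i j} (ρ : Vec (Vertex G) i) (σ : Vec (Subset (n G)) j) a b {m} →
    Walk G (lookup ρ a) (lookup ρ b) m → m < k → Sat G ρ σ (shorter k a b)
  shorter-complete (suc k) ρ σ a b p (s≤s m≤k) = within-complete k p m≤k ρ σ a b refl refl

  ¬shorter⇔minimal : ∀ k {i j} (ρ : Vec (Vertex G) i) (σ : Vec (Subset (n G)) j) a b →
    Sat G ρ σ (negF (shorter k a b)) ⇔ Minimal G (lookup ρ a) (lookup ρ b) k
  ¬shorter⇔minimal k ρ σ a b = mk⇔ lowerBound noShorter
    where
    lowerBound : ¬ Sat G ρ σ (shorter k a b) → Minimal G (lookup ρ a) (lookup ρ b) k
    lowerBound none m p with k ≤? m
    ... | yes k≤m = k≤m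
    ... | no  k≰m = ⊥-elim (none (shorter-complete k ρ σ a b p (≰⇒> k≰m)))

    noShorter : Minimal G (lookup ρ a) (lookup ρ b) k → ¬ Sat G ρ σ (shorter k a b)
    noShorter min s with shorter-sound k ρ σ a b s
    ... | m , m<k , p = <-irrefl refl (<-≤-trans m<k (min m p))

  bigOr-sat : ∀ {i j} (ρ : Vec (Vertex G) i) (σ : Vec (Subset (n G)) j) g n →
    Sat G ρ σ (bigOr g n) ⇔ Σ ℕ λ k → k ≤ n × Sat G ρ σ (g k)
  bigOr-sat ρ σ g n = mk⇔ (sound n) (λ (k , k≤n , s) → complete n k k≤n s)
    where
    sound : ∀ n → Sat G ρ σ (bigOr g n) → Σ ℕ λ k → k ≤ n × Sat G ρ σ (g k)
    sound zero    s        = 0 , z≤n , s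
    sound (suc n) (inj₂ s) = suc n , ≤-refl , s
    sound (suc n) (inj₁ s) with sound n s
    ... | k , k≤n , t = k , ≤-trans k≤n (n≤1+n n) , t

    complete : ∀ n k → k ≤ n → Sat G ρ σ (g k) → Sat G ρ σ (bigOr g n)
    complete zero    .zero z≤n s = s
    complete (suc n) k k≤1+n s with m≤n⇒m<n∨m≡n k≤1+n
    ... | inj₁ (s≤s k≤n) = inj₁ (complete n k k≤n s)
    ... | inj₂ refl      = inj₂ s

  _++ʷ_ : ∀ {u x v m m'} → Walk G u x m → Walk G x v m' → Walk G u v (m + m')
  here _     ++ʷ q = q
  step u~w p ++ʷ q = step u~w (p ++ʷ q)

  onWalk-start : ∀ {x v m} (q : Walk G x v m) → OnWalk G x q
  onWalk-start (here _)     = on-here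
  onWalk-start (step x~w q) = on-head x~w q

  onWalk-junction : ∀ {u x v m m'} (p : Walk G u x m) (q : Walk G x v m') →
    OnWalk G x (p ++ʷ q)
  onWalk-junction (here _)     q = onWalk-start q
  onWalk-junction (step u~w p) q = on-tail u~w (onWalk-junction p q)

  splitAt : ∀ {x u v d} (p : Walk G u v d) → OnWalk G x p →
    Σ ℕ λ m → Σ ℕ λ m' → Walk G u x m × Walk G x v m' × m + m' ≡ d
  splitAt (here _)     on-here             = 0 , 0 , here _ , here _ , refl
  splitAt (step u~w p) (on-head .u~w .p)   = 0 , _ , here _ , step u~w p , refl
  splitAt (step u~w p) (on-tail .u~w x∈p) with splitAt p x∈p
  ... | m , m' , p₁ , p₂ , m+m'≡d = suc m , m' , step u~w p₁ , p₂ , cong suc m+m'≡d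

  interval⇔split : ∀ u v x → InInterval G u v x ⇔
    Σ ℕ λ a → Σ ℕ λ b → Walk G u x a × Walk G x v b × Minimal G u v (a + b)
  interval⇔split u v x = mk⇔ split join
    where
    split : InInterval G u v x →
      Σ ℕ λ a → Σ ℕ λ b → Walk G u x a × Walk G x v b × Minimal G u v (a + b)
    split (d , (_ , minimal) , p , x∈p) with splitAt p x∈p
    ... | a , b , p₁ , p₂ , a+b≡d =
      a , b , p₁ , p₂ , subst (Minimal G u v) (≡-sym a+b≡d) minimal

    join : (Σ ℕ λ a → Σ ℕ λ b → Walk G u x a × Walk G x v b × Minimal G u v (a + b)) →
      InInterval G u v x
    join (a , b , p , q , minimal) =
      a + b , (p ++ʷ q , minimal) , p ++ʷ q , onWalk-junction p q

  minimal≤diam : ∀ {D u v d} → IsDiam G D → Minimal G u v d → d ≤ D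
  minimal≤diam {u = u} {v} (dist , _) minimal with dist u v
  ... | d' , (p , _) , d'≤D = ≤-trans (minimal d' p) d'≤D

-- Vertex variables of the interval formula, innermost first: v, u, x.
vᵥ uᵥ xᵥ : Fin 3
vᵥ = fz
uᵥ = fs fz
xᵥ = fs (fs fz)

throughF : ∀ {j} → ℕ → ℕ → Form 3 j
throughF a b =
  andF (within a uᵥ xᵥ) (andF (within b xᵥ vᵥ) (negF (shorter (a + b) uᵥ vᵥ)))

-- "x ∈ I[u,v]", correct whenever all distances are at most D
intervalF : ∀ {j} → ℕ → Form 3 j
intervalF D = bigOr (λ a → bigOr (λ b → throughF a b) D) D

geodeticF : ℕ → Form 0 1
geodeticF D =
  all1 (ex1 (ex1 (andF (memF uᵥ fz) (andF (memF vᵥ fz) (intervalF D)))))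

module _ (G : Graph) where

  -- `throughF a b` yields a split of a minimum-length u–v walk at x (the
  -- pieces may be shorter than a, b, but then still sum to the minimum) …
  throughF-sound : ∀ {j} (σ : Vec (Subset (n G)) j) a b u v x →
    Sat G (v ∷ u ∷ x ∷ []) σ (throughF a b) →
    Σ ℕ λ m → Σ ℕ λ m' → Walk G u x m × Walk G x v m' × Minimal G u v (m + m')
  throughF-sound σ a b u v x (ux , xv , noShorter)
    with within-sound G a ρ σ uᵥ xᵥ ux | within-sound G b ρ σ xᵥ vᵥ xv
    where ρ = v ∷ u ∷ x ∷ []
  ... | m , m≤a , p | m' , m'≤b , q =
    m , m' , p , q , λ k r → ≤-trans (+-mono-≤ m≤a m'≤b) (lowerBound k r)
    where
    lowerBound : Minimal G u v (a + b)
    lowerBound = to (¬shorter⇔minimal G (a + b) (v ∷ u ∷ x ∷ []) σ uᵥ vᵥ) noShorter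

  throughF-complete : ∀ {j} (σ : Vec (Subset (n G)) j) {a b u v x} →
    Walk G u x a → Walk G x v b → Minimal G u v (a + b) →
    Sat G (v ∷ u ∷ x ∷ []) σ (throughF a b)
  throughF-complete σ {a} {b} {u} {v} {x} p q minimal =
    within-complete G a p ≤-refl ρ σ uᵥ xᵥ refl refl ,
    within-complete G b q ≤-refl ρ σ xᵥ vᵥ refl refl ,
    from (¬shorter⇔minimal G (a + b) ρ σ uᵥ vᵥ) minimal
    where ρ = v ∷ u ∷ x ∷ []

  intervalF-sat : ∀ {D j} → IsDiam G D → (σ : Vec (Subset (n G)) j) → ∀ u v x →
    Sat G (v ∷ u ∷ x ∷ []) σ (intervalF D) ⇔ InInterval G u v x
  intervalF-sat {D} diam σ u v x = mk⇔ sound complete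
    where
    ρ = v ∷ u ∷ x ∷ []

    sound : Sat G ρ σ (intervalF D) → InInterval G u v x
    sound s with to (bigOr-sat G ρ σ _ D) s
    ... | a , _ , s' with to (bigOr-sat G ρ σ _ D) s'
    ... | b , _ , t = from (interval⇔split G u v x) (throughF-sound σ a b u v x t)

    complete : InInterval G u v x → Sat G ρ σ (intervalF D)
    complete I with to (interval⇔split G u v x) I
    ... | a , b , p , q , minimal =
      from (bigOr-sat G ρ σ _ D) (a , m+n≤o⇒m≤o a a+b≤D ,
        from (bigOr-sat G ρ σ _ D) (b , m+n≤o⇒n≤o a a+b≤D ,
          throughF-complete σ p q minimal))
      where
      a+b≤D : a + b ≤ D
      a+b≤D = minimal≤diam G diam minimal

  geodeticF-sat : ∀ {D} → IsDiam G D → ∀ S →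
    Sat G [] (S ∷ []) (geodeticF D) ⇔ Geodetic G S
  geodeticF-sat {D} diam S = mk⇔ sound complete
    where
    sound : Sat G [] (S ∷ []) (geodeticF D) → Geodetic G S
    sound s x with s x
    ... | u , v , u∈S , v∈S , I =
      u , v , u∈S , v∈S , to (intervalF-sat diam (S ∷ []) u v x) I

    complete : Geodetic G S → Sat G [] (S ∷ []) (geodeticF D)
    complete g x with g x
    ... | u , v , u∈S , v∈S , I =
      u , v , u∈S , v∈S , from (intervalF-sat diam (S ∷ []) u v x) I

mainTheorem3 : Σ (ℕ → ℕ) λ f → (G : Graph) → (D : ℕ) → IsDiam G D →
    Σ (Form 0 1) λ φ → len φ ≤ f D ×
      (∀ S → Sat G [] (S ∷ []) φ ⇔ Geodetic G S)
mainTheorem3 =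
  (λ D → len (geodeticF D)) ,
  λ G D diam → geodeticF D , ≤-refl , geodeticF-sat G diam
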